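{- Let $G$ be a cubic graph of order $n \in \{6, 8, 10, 14\}$. Then every $4$-total coloring of $G$ is equitable.
   Context: All graphs are finite, simple and cubic ($3$-regular), not necessarily connected. The order of a graph is its number of vertices. A $4$-total coloring of $G$ assigns one of the four colors $1,2,3,4$ to each vertex and each edge of $G$ so that adjacent vertices receive distinct colors, adjacent edges (edges sharing an endpoint) receive distinct colors, and every vertex and edge that are incident receive distinct colors. The color class $c_i$ is the set of all vertices and edges of color $i$. The coloring is equitable if $\bigl||c_i|-|c_j|\bigr| \le 1$ for all $i,j \in \{1,2,3,4\}$. -}

module Defs where

open import Data.Bool using (Bool; false; T)
open import Data.Bool.Properties using (T?)
open import Data.Fin using (Fin; _<_; _<?_; _≟_)
open import Data.Fin.Subset using (Subset; ∣_∣)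
open import Data.List using (List; _++_; map; mapMaybe; filter; length; allFin; cartesianProduct)
open import Data.Maybe using (Maybe; just; nothing)
open import Data.Nat using (ℕ; _≤_; ∣_-_∣)
open import Data.Product using (_×_; _,_; ∃-syntax)
open import Data.Sum using (_⊎_; inj₁; inj₂)
open import Data.Vec using (tabulate)
open import Relation.Binary.PropositionalEquality using (_≡_; _≢_)
open import Relation.Nullary using (yes; no)

-- A finite simple graph of order n, on the vertex set Fin n.
record Graph (n : ℕ) : Set where
  field
    adj       : Fin n → Fin n → Bool
    symmetric : ∀ u v → adj u v ≡ adj v u
    loopless  : ∀ v → adj v v ≡ false

module _ {n : ℕ} (G : Graph n) where
  open Graph G

  neighbours : Fin n → Subset n
  neighbours v = tabulate (adj v)

  degree : Fin n → ℕ
  degree v = ∣ neighbours v ∣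

  Cubic : Set
  Cubic = ∀ v → degree v ≡ 3

  -- The unordered edge {u , v} is represented once, with its smaller
  -- endpoint first.  Both proof fields have propositional types, so _≡_ on
  -- Edge is equality of endpoint sets.
  record Edge : Set where
    constructor edge
    field
      lo hi    : Fin n
      lo<hi    : lo < hi
      adjacent : T (adj lo hi)

  open Edge

  Incident : Fin n → Edge → Set
  Incident v e = v ≡ lo e ⊎ v ≡ hi e

  edge? : Fin n × Fin n → Maybe Edge
  edge? (u , v) with u <? v | T? (adj u v)
  ... | yes u<v | yes uv = just (edge u v u<v uv)
  ... | _       | _      = nothing

  edges : List Edge
  edges = mapMaybe edge? (cartesianProduct (allFin n) (allFin n))

  Element : Set
  Element = Fin n ⊎ Edge

  -- Every vertex and every edge, each listed exactly once.
  elements : List Element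
  elements = map inj₁ (allFin n) ++ map inj₂ edges

  record TotalColoring (k : ℕ) : Set where
    field
      color : Element → Fin k
      adjacent-vertices : ∀ u v → T (adj u v) → color (inj₁ u) ≢ color (inj₁ v)
      adjacent-edges    : ∀ e f → e ≢ f → ∃[ v ] (Incident v e × Incident v f) →
                          color (inj₂ e) ≢ color (inj₂ f)
      incident          : ∀ v e → Incident v e → color (inj₁ v) ≢ color (inj₂ e)

module _ {n k : ℕ} {G : Graph n} (c : TotalColoring G k) where
  open TotalColoring c

  colorClass : Fin k → List (Element G)
  colorClass i = filter (λ x → color x ≟ i) (elements G)

  Equitable : Set
  Equitable = ∀ i j → ∣ length (colorClass i) - length (colorClass j) ∣ ≤ 1

{-# OPTIONS --safe #-}
module Submission where

open import Defs
open import Algebra.Properties.CommutativeSemigroup using (interchange; x∙yz≈y∙xz)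
open import Data.Bool using (Bool; true; false; if_then_else_)
open import Data.Bool.Properties using (T?)
open import Data.Fin using (Fin; zero; suc; toℕ; fromℕ<; _≟_; _<?_)
open import Data.Fin.Properties using (all?; toℕ-fromℕ<; <-cmp; <-irrefl)
open import Data.Fin.Subset using (∣_∣)
open import Data.List
  using (List; []; _∷_; _++_; map; mapMaybe; filter; length; tabulate; allFin; cartesianProduct)
open import Data.List.Membership.Propositional using (_∈_)
open import Data.List.Membership.Propositional.Properties using (∈-allFin)
open import Data.List.Properties using (map-++; map-∘; map-cong; map-tabulate; length-tabulate)
open import Data.List.Relation.Unary.All as All using (All; []; _∷_)
import Data.List.Relation.Unary.All.Properties as All
open import Data.List.Relation.Unary.AllPairs as AllPairs using (AllPairs; []; _∷_)
open import Data.List.Relation.Unary.Any using (here; there)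
open import Data.List.Relation.Unary.Unique.Propositional using (Unique)
open import Data.List.Relation.Unary.Unique.Propositional.Properties
  using (allFin⁺; cartesianProduct⁺)
open import Data.Maybe using (Maybe; just; nothing; maybe′)
import Data.Maybe.Relation.Unary.All as Maybe
open import Data.Nat as ℕ using (ℕ; zero; suc; _+_; _*_; _∸_; _≤_; _≤?_; z≤n; s≤s; ∣_-_∣)
open import Data.Nat.ListAction using (sum)
open import Data.Nat.ListAction.Properties using (sum-++)
open import Data.Nat.Properties
  using ( ≤-refl; ≤-reflexive; ≤-trans; ≤-antisym; +-mono-≤; +-monoʳ-≤; *-mono-≤
        ; +-cancelˡ-≤; +-cancelʳ-≤; *-cancelˡ-≤; +-identityʳ; *-identityʳ; *-zeroʳ
        ; *-distribˡ-+; *-distribʳ-+; m≤n+m; m+n∸n≡m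
        ; +-commutativeSemigroup; *-commutativeSemigroup; module ≤-Reasoning)
open import Data.Product using (_×_; _,_)
open import Data.Sum using (_⊎_; inj₁; inj₂)
import Data.Vec as Vec
open import Function using (id; _∘_)
open import Level using (0ℓ)
open import Relation.Binary.Definitions using (tri<; tri≈; tri>)
open import Relation.Binary.PropositionalEquality
  using (_≡_; _≢_; refl; sym; trans; cong; cong₂; subst; subst₂; module ≡-Reasoning)
open import Relation.Nullary using (Dec; yes; no; does; ¬_; contradiction)
open import Relation.Nullary.Decidable
  using (_→-dec_; _⊎-dec_; ¬?; from-yes; dec-true; dec-false)
open import Relation.Unary using (Pred; Decidable)

-- Let xᵢ and yᵢ be the numbers of vertices and edges of colour i.  A vertex and
-- its three edges use each of the four colours exactly once, so every vertex not
-- of colour i is covered by exactly one edge of colour i; hence xᵢ + 2 yᵢ = n.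
-- For j ≠ i the vertices of colour j are independent and all covered by edges of
-- colour i, so xⱼ ≤ yᵢ.  Together with Σ xᵢ = n, these constraints force
-- equitability for the given values of n, by a finite search over the yᵢ.

private variable
  A B : Set

-- Indicators and finite sums of natural numbers.

𝟙 : ∀ {p} {P : Set p} → Dec P → ℕ
𝟙 P? = if does P? then 1 else 0

𝟙-yes : ∀ {p} {P : Set p} (P? : Dec P) → P → 𝟙 P? ≡ 1
𝟙-yes P? p rewrite dec-true P? p = refl

𝟙-no : ∀ {p} {P : Set p} (P? : Dec P) → ¬ P → 𝟙 P? ≡ 0
𝟙-no P? ¬p rewrite dec-false P? ¬p = refl

𝟙≤1 : ∀ {p} {P : Set p} (P? : Dec P) → 𝟙 P? ≤ 1
𝟙≤1 (yes _) = ≤-refl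
𝟙≤1 (no _)  = z≤n

𝟙*𝟙 : ∀ {p q} {P : Set p} {Q : Set q} (P? : Dec P) (Q? : Dec Q) → 𝟙 P? * 𝟙 Q? ≡ 0 ⊎ (P × Q)
𝟙*𝟙 (no _)  _       = inj₁ refl
𝟙*𝟙 (yes _) (no _)  = inj₁ refl
𝟙*𝟙 (yes p) (yes q) = inj₂ (p , q)

∑ : List A → (A → ℕ) → ℕ
∑ xs f = sum (map f xs)

∑-cong : ∀ (xs : List A) {f g : A → ℕ} → (∀ x → f x ≡ g x) → ∑ xs f ≡ ∑ xs g
∑-cong xs f≗g = cong sum (map-cong f≗g xs)

∑-mono : ∀ (xs : List A) {f g : A → ℕ} → (∀ x → f x ≤ g x) → ∑ xs f ≤ ∑ xs g
∑-mono []       f≤g = z≤n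
∑-mono (x ∷ xs) f≤g = +-mono-≤ (f≤g x) (∑-mono xs f≤g)

∑-zero : ∀ (xs : List A) → ∑ xs (λ _ → 0) ≡ 0
∑-zero []       = refl
∑-zero (_ ∷ xs) = ∑-zero xs

∑-one : ∀ (xs : List A) → ∑ xs (λ _ → 1) ≡ length xs
∑-one []       = refl
∑-one (_ ∷ xs) = cong suc (∑-one xs)

∑-+ : ∀ (xs : List A) (f g : A → ℕ) → ∑ xs (λ x → f x + g x) ≡ ∑ xs f + ∑ xs g
∑-+ []       f g = refl
∑-+ (x ∷ xs) f g =
  trans (cong (f x + g x +_) (∑-+ xs f g)) (interchange +-commutativeSemigroup (f x) (g x) (∑ xs f) (∑ xs g))

∑-*ˡ : ∀ (xs : List A) k (f : A → ℕ) → ∑ xs (λ x → k * f x) ≡ k * ∑ xs f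
∑-*ˡ []       k f = sym (*-zeroʳ k)
∑-*ˡ (x ∷ xs) k f =
  trans (cong (k * f x +_) (∑-*ˡ xs k f)) (sym (*-distribˡ-+ k (f x) (∑ xs f)))

∑-swap : ∀ (xs : List A) (ys : List B) (f : A → B → ℕ) →
         ∑ xs (λ x → ∑ ys (f x)) ≡ ∑ ys (λ y → ∑ xs (λ x → f x y))
∑-swap []       ys f = sym (∑-zero ys)
∑-swap (x ∷ xs) ys f =
  trans (cong (∑ ys (f x) +_) (∑-swap xs ys f)) (sym (∑-+ ys (f x) _))

∑-++ : ∀ (xs ys : List A) (f : A → ℕ) → ∑ (xs ++ ys) f ≡ ∑ xs f + ∑ ys f
∑-++ xs ys f = trans (cong sum (map-++ f xs ys)) (sum-++ (map f xs) (map f ys))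

∑-map : ∀ (xs : List A) (g : A → B) (f : B → ℕ) → ∑ (map g xs) f ≡ ∑ xs (f ∘ g)
∑-map xs g f = cong sum (sym (map-∘ xs))

∑-mapMaybe : ∀ (xs : List A) (p : A → Maybe B) (f : B → ℕ) →
             ∑ (mapMaybe p xs) f ≡ ∑ xs (λ x → maybe′ f 0 (p x))
∑-mapMaybe []       p f = refl
∑-mapMaybe (x ∷ xs) p f with p x
... | nothing = ∑-mapMaybe xs p f
... | just y  = cong (f y +_) (∑-mapMaybe xs p f)

∑-cartesianProduct : ∀ (xs : List A) (ys : List B) (f : A × B → ℕ) →
                     ∑ (cartesianProduct xs ys) f ≡ ∑ xs (λ x → ∑ ys (λ y → f (x , y)))
∑-cartesianProduct []       ys f = refl
∑-cartesianProduct (x ∷ xs) ys f =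
  trans (∑-++ (map (x ,_) ys) (cartesianProduct xs ys) f)
        (cong₂ _+_ (∑-map ys (x ,_) f) (∑-cartesianProduct xs ys f))

length-filter-∑ : ∀ {P : Pred A 0ℓ} (P? : Decidable P) (xs : List A) →
                  length (filter P? xs) ≡ ∑ xs (λ x → 𝟙 (P? x))
length-filter-∑ P? []       = refl
length-filter-∑ P? (x ∷ xs) with does (P? x)
... | true  = cong suc (length-filter-∑ P? xs)
... | false = length-filter-∑ P? xs

-- Once a term equals 1, the pairwise condition makes all later terms vanish. The intended terms are
-- the edges of one colour at a vertex, which properness makes mutually exclusive.
∑-≤1 : ∀ {xs : List A} {f : A → ℕ} → (∀ x → f x ≤ 1) →
       AllPairs (λ x y → f x ≡ 0 ⊎ f y ≡ 0) xs → ∑ xs f ≤ 1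
∑-≤1 f≤1 [] = z≤n
∑-≤1 {xs = x ∷ xs} {f} f≤1 (px ∷ pxs) with f x | f≤1 x
... | zero        | _ = ∑-≤1 f≤1 pxs
... | suc zero    | _ = ≤-reflexive (cong suc (vanish px))
  where
  vanish : ∀ {ys} → All (λ y → 1 ≡ 0 ⊎ f y ≡ 0) ys → ∑ ys f ≡ 0
  vanish []               = refl
  vanish (inj₁ () ∷ _)
  vanish (inj₂ fy≡0 ∷ ps) = cong₂ _+_ fy≡0 (vanish ps)
... | suc (suc _) | s≤s ()

-- Pigeonhole without slack: the tail sums to at most its length, so the head must contribute a full
-- 1; as it contributes no more, the tail is saturated in turn.
∑-saturated : ∀ {xs : List A} {f : A → ℕ} → (∀ x → f x ≤ 1) → length xs ≤ ∑ xs f →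
              ∀ {x} → x ∈ xs → f x ≡ 1
∑-saturated {xs = y ∷ ys} {f} f≤1 full x∈ = go x∈
  where
  ∑≤length : ∀ zs → ∑ zs f ≤ length zs
  ∑≤length zs = ≤-trans (∑-mono zs f≤1) (≤-reflexive (∑-one zs))

  go : ∀ {x} → x ∈ y ∷ ys → f x ≡ 1
  go (here refl) = ≤-antisym (f≤1 y)
    (+-cancelʳ-≤ (length ys) 1 (f y) (≤-trans full (+-monoʳ-≤ (f y) (∑≤length ys))))
  go (there x∈ys) = ∑-saturated f≤1
    (+-cancelˡ-≤ 1 _ _ (≤-trans full (+-mono-≤ (f≤1 y) ≤-refl))) x∈ys

∑-allFin-suc : ∀ {n} (f : Fin (suc n) → ℕ) → ∑ (allFin (suc n)) f ≡ f zero + ∑ (allFin n) (f ∘ suc)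
∑-allFin-suc {n} f =
  cong (λ xs → f zero + sum xs) (trans (map-tabulate suc f) (sym (map-tabulate id (f ∘ suc))))

-- Sifting by a Kronecker delta; it collapses sums over vertices to the endpoints of an edge.
∑-point : ∀ {n} (u : Fin n) (g : Fin n → ℕ) → ∑ (allFin n) (λ v → 𝟙 (v ≟ u) * g v) ≡ g u
∑-point {suc n} zero g = begin
  ∑ (allFin (suc n)) (λ v → 𝟙 (v ≟ zero) * g v)   ≡⟨ ∑-allFin-suc (λ v → 𝟙 (v ≟ zero) * g v) ⟩
  g zero + 0 + ∑ (allFin n) (λ _ → 0)             ≡⟨ cong₂ _+_ (+-identityʳ (g zero)) (∑-zero (allFin n)) ⟩
  g zero + 0                                      ≡⟨ +-identityʳ (g zero) ⟩
  g zero                                          ∎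
  where open ≡-Reasoning
∑-point {suc n} (suc u) g = trans (∑-allFin-suc (λ v → 𝟙 (v ≟ suc u) * g v)) (∑-point u (g ∘ suc))

∑-point′ : ∀ {n} (u : Fin n) (g : Fin n → ℕ) → ∑ (allFin n) (λ v → 𝟙 (u ≟ v) * g v) ≡ g u
∑-point′ {n} u g = trans (∑-cong (allFin n) (λ v → cong (_* g v) (≟-sym v))) (∑-point u g)
  where
  ≟-sym : ∀ v → 𝟙 (u ≟ v) ≡ 𝟙 (v ≟ u)
  ≟-sym v with u ≟ v
  ... | yes u≡v = sym (𝟙-yes (v ≟ u) (sym u≡v))
  ... | no  u≢v = sym (𝟙-no (v ≟ u) (u≢v ∘ sym))

∑-indicator : ∀ {m} (j : Fin m) → ∑ (allFin m) (λ i → 𝟙 (j ≟ i)) ≡ 1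
∑-indicator {m} j =
  trans (∑-cong (allFin m) (λ i → sym (*-identityʳ (𝟙 (j ≟ i))))) (∑-point′ j (λ _ → 1))

-- Turns `degree`, a subset cardinality, into a sum that can be compared with a count of edges.
∣tabulate∣-∑ : ∀ {n} (f : Fin n → Bool) → ∣ Vec.tabulate f ∣ ≡ ∑ (allFin n) (λ v → if f v then 1 else 0)
∣tabulate∣-∑ {zero}  f = refl
∣tabulate∣-∑ {suc n} f = trans head (sym (∑-allFin-suc (λ v → if f v then 1 else 0)))
  where
  head : ∣ Vec.tabulate f ∣ ≡ (if f zero then 1 else 0) + ∑ (allFin n) (λ v → if f (suc v) then 1 else 0)
  head with f zero
  ... | true  = cong suc (∣tabulate∣-∑ (f ∘ suc))
  ... | false = ∣tabulate∣-∑ (f ∘ suc)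

-- Edges: distinctness in the list, and incidence counts.

mapMaybe-unique : ∀ {p : A → Maybe B} {xs} → (∀ {x y z} → p x ≡ just z → p y ≡ just z → x ≡ y) →
                  Unique xs → Unique (mapMaybe p xs)
mapMaybe-unique inj [] = []
mapMaybe-unique {p = p} {x ∷ xs} inj (x∉xs ∷ xs!) with p x in px≡
... | nothing = mapMaybe-unique inj xs!
... | just z  = All.mapMaybe⁺ (All.map⁺ (All.map new x∉xs)) ∷ mapMaybe-unique inj xs!
  where
  new : ∀ {y} → x ≢ y → Maybe.All (z ≢_) (p y)
  new {y} x≢y with p y in py≡
  ... | nothing = Maybe.nothing
  ... | just w  = Maybe.just λ { refl → x≢y (inj px≡ py≡) }

module _ {n : ℕ} (G : Graph n) where
  open Graph G
  open Edge

  -- An edge remembers its endpoints, so `edge?` is injective where it succeeds; hence the entries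
  -- of `edges` are distinct.
  edge?-just : ∀ {p e} → edge? G p ≡ just e → p ≡ (lo e , hi e)
  edge?-just {u , v} eq with u <? v | T? (adj u v)
  edge?-just {u , v} refl | yes _ | yes _ = refl
  edge?-just {u , v} ()   | yes _ | no _
  edge?-just {u , v} ()   | no _  | yes _
  edge?-just {u , v} ()   | no _  | no _

  edges-unique : Unique (edges G)
  edges-unique = mapMaybe-unique (λ p q → trans (edge?-just p) (sym (edge?-just q)))
    (cartesianProduct⁺ (allFin⁺ n) (allFin⁺ n))

  Incident? : ∀ v e → Dec (Incident G v e)
  Incident? v e = (v ≟ lo e) ⊎-dec (v ≟ hi e)

  -- The order `lo<hi` is strict, so the two ways of being incident exclude each other and their
  -- indicators add.
  𝟙-incident : ∀ v e → 𝟙 (Incident? v e) ≡ 𝟙 (v ≟ lo e) + 𝟙 (v ≟ hi e)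
  𝟙-incident v e with v ≟ lo e | v ≟ hi e
  ... | yes refl | yes v≡hi = contradiction (lo<hi e) (<-irrefl v≡hi)
  ... | yes _    | no _     = refl
  ... | no _     | yes _    = refl
  ... | no _     | no _     = refl

  ∑-endpoints : ∀ e (g : Fin n → ℕ) → ∑ (allFin n) (λ v → 𝟙 (Incident? v e) * g v) ≡ g (lo e) + g (hi e)
  ∑-endpoints e g = begin
    ∑ (allFin n) (λ v → 𝟙 (Incident? v e) * g v)
      ≡⟨ ∑-cong (allFin n) (λ v → trans (cong (_* g v) (𝟙-incident v e))
                                        (*-distribʳ-+ (g v) (𝟙 (v ≟ lo e)) _)) ⟩
    ∑ (allFin n) (λ v → 𝟙 (v ≟ lo e) * g v + 𝟙 (v ≟ hi e) * g v)
      ≡⟨ ∑-+ (allFin n) (λ v → 𝟙 (v ≟ lo e) * g v) _ ⟩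
    ∑ (allFin n) (λ v → 𝟙 (v ≟ lo e) * g v) + ∑ (allFin n) (λ v → 𝟙 (v ≟ hi e) * g v)
      ≡⟨ cong₂ _+_ (∑-point (lo e) g) (∑-point (hi e) g) ⟩
    g (lo e) + g (hi e) ∎
    where open ≡-Reasoning

  -- Edges are listed as pairs u < v, so {u , v} is counted by exactly one of arc u v and arc v u.
  arc : Fin n → Fin n → ℕ
  arc u v = 𝟙 (u <? v) * 𝟙 (T? (adj u v))

  arc-+-arc : ∀ u v → arc u v + arc v u ≡ (if adj u v then 1 else 0)
  arc-+-arc u v with <-cmp u v
  ... | tri< u<v _ v≮u rewrite 𝟙-yes (u <? v) u<v | 𝟙-no (v <? u) v≮u =
    trans (+-identityʳ _) (+-identityʳ _)
  ... | tri> u≮v _ v<u rewrite 𝟙-no (u <? v) u≮v | 𝟙-yes (v <? u) v<u | symmetric u v =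
    +-identityʳ _
  ... | tri≈ u≮v refl _ rewrite 𝟙-no (u <? v) u≮v | loopless u = refl

  -- The list `edges` unfolds to all ordered pairs (u , w). Incidence splits by whether v is the
  -- smaller or the larger end, and the two counts of arcs out of v and into v add up to the row of
  -- v in the adjacency matrix.
  ∑-incident : ∀ v → ∑ (edges G) (λ e → 𝟙 (Incident? v e)) ≡ degree G v
  ∑-incident v = begin
    ∑ (edges G) (λ e → 𝟙 (Incident? v e))
      ≡⟨ ∑-mapMaybe (cartesianProduct V V) (edge? G) _ ⟩
    ∑ (cartesianProduct V V) (λ p → maybe′ (λ e → 𝟙 (Incident? v e)) 0 (edge? G p))
      ≡⟨ ∑-cartesianProduct V V _ ⟩
    ∑ V (λ u → ∑ V (λ w → maybe′ (λ e → 𝟙 (Incident? v e)) 0 (edge? G (u , w))))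
      ≡⟨ ∑-cong V (λ u → trans (∑-cong V (λ w → pointwise u w)) (∑-+ V (λ w → 𝟙 (v ≟ u) * arc u w) _)) ⟩
    ∑ V (λ u → ∑ V (λ w → 𝟙 (v ≟ u) * arc u w) + ∑ V (λ w → 𝟙 (v ≟ w) * arc u w))
      -- The factor `𝟙 (v ≟ u)` does not depend on w and is pulled out; the second inner sum keeps
      -- only w = v.
      ≡⟨ ∑-cong V (λ u → cong₂ _+_ (∑-*ˡ V (𝟙 (v ≟ u)) (arc u)) (∑-point′ v (arc u))) ⟩
    ∑ V (λ u → 𝟙 (v ≟ u) * ∑ V (arc u) + arc u v)
      ≡⟨ ∑-+ V (λ u → 𝟙 (v ≟ u) * ∑ V (arc u)) _ ⟩
    ∑ V (λ u → 𝟙 (v ≟ u) * ∑ V (arc u)) + ∑ V (λ u → arc u v)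
      ≡⟨ cong (_+ ∑ V (λ u → arc u v)) (∑-point′ v (λ u → ∑ V (arc u))) ⟩
    ∑ V (arc v) + ∑ V (λ u → arc u v)
      ≡⟨ ∑-+ V (arc v) _ ⟨
    ∑ V (λ u → arc v u + arc u v)
      ≡⟨ ∑-cong V (arc-+-arc v) ⟩
    ∑ V (λ u → if adj v u then 1 else 0)
      ≡⟨ ∣tabulate∣-∑ (adj v) ⟨
    degree G v ∎
    where
    open ≡-Reasoning
    V = allFin n

    pointwise : ∀ u w → maybe′ (λ e → 𝟙 (Incident? v e)) 0 (edge? G (u , w)) ≡
                        𝟙 (v ≟ u) * arc u w + 𝟙 (v ≟ w) * arc u w
    pointwise u w with u <? w | T? (adj u w)
    ... | yes u<w | yes uw rewrite 𝟙-yes (u <? w) u<w | 𝟙-yes (T? (adj u w)) uw =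
      trans (𝟙-incident v (edge u w u<w uw))
            (sym (cong₂ _+_ (*-identityʳ (𝟙 (v ≟ u))) (*-identityʳ (𝟙 (v ≟ w)))))
    ... | yes u<w | no ¬uw rewrite 𝟙-yes (u <? w) u<w | 𝟙-no (T? (adj u w)) ¬uw =
      sym (cong₂ _+_ (*-zeroʳ (𝟙 (v ≟ u))) (*-zeroʳ (𝟙 (v ≟ w))))
    ... | no u≮w  | yes _  rewrite 𝟙-no (u <? w) u≮w =
      sym (cong₂ _+_ (*-zeroʳ (𝟙 (v ≟ u))) (*-zeroʳ (𝟙 (v ≟ w))))
    ... | no u≮w  | no _   rewrite 𝟙-no (u <? w) u≮w =
      sym (cong₂ _+_ (*-zeroʳ (𝟙 (v ≟ u))) (*-zeroʳ (𝟙 (v ≟ w))))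

-- Counting the vertices and edges of each colour.

module _ {n k : ℕ} {G : Graph n} (c : TotalColoring G k) where
  open TotalColoring c
  open Edge

  vertexClassSize edgeClassSize : Fin k → ℕ
  vertexClassSize i = ∑ (allFin n) (λ v → 𝟙 (color (inj₁ v) ≟ i))
  edgeClassSize i   = ∑ (edges G) (λ e → 𝟙 (color (inj₂ e) ≟ i))

  length-colorClass : ∀ i → length (colorClass c i) ≡ vertexClassSize i + edgeClassSize i
  length-colorClass i = begin
    length (colorClass c i)
      ≡⟨ length-filter-∑ (λ x → color x ≟ i) (elements G) ⟩
    ∑ (elements G) (λ x → 𝟙 (color x ≟ i))
      ≡⟨ ∑-++ (map inj₁ (allFin n)) _ _ ⟩
    ∑ (map inj₁ (allFin n)) (λ x → 𝟙 (color x ≟ i)) + ∑ (map inj₂ (edges G)) (λ x → 𝟙 (color x ≟ i))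
      ≡⟨ cong₂ _+_ (∑-map (allFin n) inj₁ _) (∑-map (edges G) inj₂ _) ⟩
    vertexClassSize i + edgeClassSize i ∎
    where open ≡-Reasoning

  ∑-vertexClassSize : ∑ (allFin k) vertexClassSize ≡ n
  ∑-vertexClassSize = begin
    ∑ (allFin k) vertexClassSize
      ≡⟨ ∑-swap (allFin k) (allFin n) _ ⟩
    ∑ (allFin n) (λ v → ∑ (allFin k) (λ i → 𝟙 (color (inj₁ v) ≟ i)))
      ≡⟨ ∑-cong (allFin n) (λ v → ∑-indicator (color (inj₁ v))) ⟩
    ∑ (allFin n) (λ _ → 1)
      ≡⟨ ∑-one (allFin n) ⟩
    length (allFin n)
      ≡⟨ length-tabulate id ⟩
    n ∎
    where open ≡-Reasoning

  edgesAt : Fin n → Fin k → ℕ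
  edgesAt v i = ∑ (edges G) (λ e → 𝟙 (Incident? G v e) * 𝟙 (color (inj₂ e) ≟ i))

  -- Two distinct edges counted here would share both v and the colour i, against `adjacent-edges`.
  edgesAt-≤1 : ∀ v i → edgesAt v i ≤ 1
  edgesAt-≤1 v i = ∑-≤1 (λ e → *-mono-≤ (𝟙≤1 (Incident? G v e)) (𝟙≤1 (color (inj₂ e) ≟ i)))
                        (AllPairs.map (λ {e} {f} → clash e f) (edges-unique G))
    where
    h : Edge G → ℕ
    h e = 𝟙 (Incident? G v e) * 𝟙 (color (inj₂ e) ≟ i)

    clash : ∀ e f → e ≢ f → h e ≡ 0 ⊎ h f ≡ 0
    clash e f e≢f with 𝟙*𝟙 (Incident? G v e) (color (inj₂ e) ≟ i) | 𝟙*𝟙 (Incident? G v f) (color (inj₂ f) ≟ i)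
    ... | inj₁ he≡0      | _              = inj₁ he≡0
    ... | inj₂ _         | inj₁ hf≡0      = inj₂ hf≡0
    ... | inj₂ (ve , ei) | inj₂ (vf , fi) =
      contradiction (trans ei (sym fi)) (adjacent-edges e f e≢f (v , ve , vf))

  occurrences : Fin n → Fin k → ℕ
  occurrences v i = 𝟙 (color (inj₁ v) ≟ i) + edgesAt v i

  occurrences-≤1 : ∀ v i → occurrences v i ≤ 1
  occurrences-≤1 v i with color (inj₁ v) ≟ i
  ... | no _     = edgesAt-≤1 v i
  -- Here i is the colour of v itself, so by `incident` no edge at v has it.
  ... | yes refl = ≤-reflexive (cong suc (trans (∑-cong (edges G) none) (∑-zero (edges G))))
    where
    none : ∀ e → 𝟙 (Incident? G v e) * 𝟙 (color (inj₂ e) ≟ color (inj₁ v)) ≡ 0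
    none e with 𝟙*𝟙 (Incident? G v e) (color (inj₂ e) ≟ color (inj₁ v))
    ... | inj₁ ≡0        = ≡0
    ... | inj₂ (ve , ev) = contradiction (sym ev) (incident v e ve)

  -- Summing over all colours forgets them: v counts once, and so does each incident edge.
  ∑-occurrences : ∀ v → ∑ (allFin k) (occurrences v) ≡ suc (degree G v)
  ∑-occurrences v = begin
    ∑ (allFin k) (occurrences v)
      ≡⟨ ∑-+ (allFin k) (λ i → 𝟙 (color (inj₁ v) ≟ i)) _ ⟩
    ∑ (allFin k) (λ i → 𝟙 (color (inj₁ v) ≟ i)) + ∑ (allFin k) (edgesAt v)
      ≡⟨ cong₂ _+_ (∑-indicator (color (inj₁ v))) (∑-swap (allFin k) (edges G) _) ⟩
    suc (∑ (edges G) (λ e → ∑ (allFin k) (λ i → 𝟙 (Incident? G v e) * 𝟙 (color (inj₂ e) ≟ i))))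
      ≡⟨ cong suc (∑-cong (edges G) (λ e → trans (∑-*ˡ (allFin k) (𝟙 (Incident? G v e)) _)
           (trans (cong (𝟙 (Incident? G v e) *_) (∑-indicator (color (inj₂ e)))) (*-identityʳ _)))) ⟩
    suc (∑ (edges G) (λ e → 𝟙 (Incident? G v e)))
      ≡⟨ cong suc (∑-incident G v) ⟩
    suc (degree G v) ∎
    where open ≡-Reasoning

  module _ (tight : ∀ v → k ≡ suc (degree G v)) where

    -- By `tight` there are as many colours as elements at v, namely v and its edges. No colour
    -- occurs twice among them, so none can be missing.
    occurrences≡1 : ∀ v i → occurrences v i ≡ 1
    occurrences≡1 v i = ∑-saturated (occurrences-≤1 v)
      (≤-reflexive (trans (length-tabulate id) (trans (tight v) (sym (∑-occurrences v)))))
      (∈-allFin i)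

    -- Sums `occurrences≡1` over all vertices; an edge of colour i is seen from both of its ends,
    -- which gives the factor 2.
    vertexClassSize+2*edgeClassSize : ∀ i → vertexClassSize i + 2 * edgeClassSize i ≡ n
    vertexClassSize+2*edgeClassSize i = begin
      vertexClassSize i + 2 * edgeClassSize i
        ≡⟨ cong (vertexClassSize i +_) (∑-*ˡ (edges G) 2 _) ⟨
      vertexClassSize i + ∑ (edges G) (λ e → 2 * col e)
        ≡⟨ cong (vertexClassSize i +_) (∑-cong (edges G) (λ e →
             trans (∑-endpoints G e (λ _ → col e)) (cong (col e +_) (sym (+-identityʳ _))))) ⟨
      vertexClassSize i + ∑ (edges G) (λ e → ∑ (allFin n) (λ v → 𝟙 (Incident? G v e) * col e))
        ≡⟨ cong (vertexClassSize i +_) (∑-swap (edges G) (allFin n) _) ⟩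
      vertexClassSize i + ∑ (allFin n) (λ v → edgesAt v i)
        ≡⟨ ∑-+ (allFin n) (λ v → 𝟙 (color (inj₁ v) ≟ i)) _ ⟨
      ∑ (allFin n) (λ v → occurrences v i)
        ≡⟨ ∑-cong (allFin n) (λ v → occurrences≡1 v i) ⟩
      ∑ (allFin n) (λ _ → 1)
        ≡⟨ ∑-one (allFin n) ⟩
      length (allFin n)
        ≡⟨ length-tabulate id ⟩
      n ∎
      where
      open ≡-Reasoning
      col : Edge G → ℕ
      col e = 𝟙 (color (inj₂ e) ≟ i)

    -- Double counting of incident pairs (v , e) with v of colour j and e of colour i: each such v
    -- lies in exactly one pair, each such e in at most one.
    vertexClassSize≤edgeClassSize : ∀ {i j} → i ≢ j → vertexClassSize j ≤ edgeClassSize i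
    vertexClassSize≤edgeClassSize {i} {j} i≢j = begin
      ∑ (allFin n) vert
        ≡⟨ ∑-cong (allFin n) covered ⟩
      ∑ (allFin n) (λ v → vert v * edgesAt v i)
        ≡⟨ ∑-cong (allFin n) (λ v → ∑-*ˡ (edges G) (vert v) _) ⟨
      ∑ (allFin n) (λ v → ∑ (edges G) (λ e → vert v * (𝟙 (Incident? G v e) * col e)))
        ≡⟨ ∑-swap (allFin n) (edges G) _ ⟩
      ∑ (edges G) (λ e → ∑ (allFin n) (λ v → vert v * (𝟙 (Incident? G v e) * col e)))
        ≡⟨ ∑-cong (edges G) (λ e → trans
             (∑-cong (allFin n) (λ v →
               x∙yz≈y∙xz *-commutativeSemigroup (vert v) (𝟙 (Incident? G v e)) (col e)))
             (∑-endpoints G e (λ v → vert v * col e))) ⟩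
      ∑ (edges G) (λ e → vert (lo e) * col e + vert (hi e) * col e)
        ≤⟨ ∑-mono (edges G) oneEnd ⟩
      ∑ (edges G) col ∎
      where
      open ≤-Reasoning
      vert : Fin n → ℕ
      vert v = 𝟙 (color (inj₁ v) ≟ j)
      col : Edge G → ℕ
      col e = 𝟙 (color (inj₂ e) ≟ i)

      covered : ∀ v → vert v ≡ vert v * edgesAt v i
      covered v with color (inj₁ v) ≟ j
      ... | no _     = refl
      -- The vertex v does not supply colour i itself, since its colour is j; so exactly one of its
      -- edges does.
      ... | yes refl = sym (trans (+-identityʳ _)
        (trans (cong (_+ edgesAt v i) (sym (𝟙-no (color (inj₁ v) ≟ i) (i≢j ∘ sym)))) (occurrences≡1 v i)))

      oneEnd : ∀ e → vert (lo e) * col e + vert (hi e) * col e ≤ col e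
      oneEnd e with color (inj₁ (lo e)) ≟ j | color (inj₁ (hi e)) ≟ j
      -- Only here could an edge be counted twice; its ends are adjacent, so they cannot share the
      -- colour j.
      ... | yes lo≡j | yes hi≡j = contradiction (trans lo≡j (sym hi≡j)) (adjacent-vertices _ _ (adjacent e))
      ... | yes _    | no _     = ≤-reflexive (trans (+-identityʳ _) (+-identityʳ _))
      ... | no _     | yes _    = ≤-reflexive (+-identityʳ _)
      ... | no _     | no _     = z≤n

-- The arithmetic constraints and their exhaustive check.

-- Under the first premise class i has size n - yᵢ, so the conclusion amounts to the yᵢ differing by
-- at most 1.
Balanced : ℕ → (Fin 4 → ℕ) → (Fin 4 → ℕ) → Set
Balanced n x y = (∀ i → x i + 2 * y i ≡ n) → ∑ (allFin 4) x ≡ n → (∀ i j → i ≢ j → x j ≤ y i) →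
                 ∀ i j → ∣ (x i + y i) - (x j + y j) ∣ ≤ 1

balanced? : ∀ n x y → Dec (Balanced n x y)
balanced? n x y =
  all? (λ i → x i + 2 * y i ℕ.≟ n) →-dec
  ∑ (allFin 4) x ℕ.≟ n →-dec
  all? (λ i → all? λ j → ¬? (i ≟ j) →-dec x j ≤? y i) →-dec
  all? (λ i → all? λ j → ∣ (x i + y i) - (x j + y j) ∣ ≤? 1)

-- Encoding a function on `Fin 4` by its four values turns quantification over functions into four
-- nested uses of `all?`.
vec4 : A → A → A → A → Fin 4 → A
vec4 a b c d = Vec.lookup (a Vec.∷ b Vec.∷ c Vec.∷ d Vec.∷ Vec.[])

-- Truncated subtraction is harmless: if 2 yᵢ > n, the first premise of Balanced fails.
AllBalanced : ℕ → Set
AllBalanced n = ∀ (a b c d : Fin 8) →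
  Balanced n (λ i → n ∸ 2 * toℕ (vec4 a b c d i)) (λ i → toℕ (vec4 a b c d i))

allBalanced? : ∀ n → Dec (AllBalanced n)
allBalanced? n = all? λ a → all? λ b → all? λ c → all? λ d → balanced? n _ _

-- Evaluates all 4096 quadruples for each order. Order 12 could not join the list: x = (0, 4, 4, 4)
-- and y = (6, 4, 4, 4) meet every constraint, yet give class sizes 6 and 8.
allBalanced : All AllBalanced (6 ∷ 8 ∷ 10 ∷ 14 ∷ [])
allBalanced = from-yes (All.all? allBalanced? (6 ∷ 8 ∷ 10 ∷ 14 ∷ []))

-- The search covers functions tabulated through `vec4`, which agree with given x and y only
-- pointwise.
Balanced-resp-≗ : ∀ {n x x′ y y′} → (∀ i → x i ≡ x′ i) → (∀ i → y i ≡ y′ i) →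
                  Balanced n x y → Balanced n x′ y′
Balanced-resp-≗ x≗ y≗ bal x′+2y′≡n ∑x′≡n x′≤y′ i j =
  subst (_≤ 1) (cong₂ ∣_-_∣ (cong₂ _+_ (x≗ i) (y≗ i)) (cong₂ _+_ (x≗ j) (y≗ j)))
    (bal (λ i → trans (cong₂ (λ m k → m + 2 * k) (x≗ i) (y≗ i)) (x′+2y′≡n i))
         (trans (∑-cong (allFin 4) x≗) ∑x′≡n)
         (λ i j i≢j → subst₂ _≤_ (sym (x≗ j)) (sym (y≗ i)) (x′≤y′ i j i≢j)) i j)

-- The first premise bounds each yᵢ by n/2 and recovers xᵢ as n ∸ 2 yᵢ, so any x and y satisfying it
-- form one of the searched cases.
balanced : ∀ {n} → n ∈ 6 ∷ 8 ∷ 10 ∷ 14 ∷ [] → ∀ x y → Balanced n x y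
balanced {n} n∈ x y x+2y≡n = Balanced-resp-≗ {n} {x = λ i → n ∸ 2 * toℕ (Y i)} x≗ y≗
  (All.lookup allBalanced n∈ _ _ _ _) x+2y≡n
  where
  n≤14 : n ≤ 14
  n≤14 = All.lookup (from-yes (All.all? (_≤? 14) (6 ∷ 8 ∷ 10 ∷ 14 ∷ []))) n∈

  y≤7 : ∀ i → y i ≤ 7
  -- The largest order is 14, so 2 yᵢ ≤ 14; this is why `Fin 8` suffices for the search.
  y≤7 i = *-cancelˡ-≤ 2 (≤-trans (m≤n+m (2 * y i) (x i)) (≤-trans (≤-reflexive (x+2y≡n i)) n≤14))

  y< : Fin 4 → Fin 8
  y< i = fromℕ< (s≤s (y≤7 i))

  Y : Fin 4 → Fin 8
  Y = vec4 (y< zero) (y< (suc zero)) (y< (suc (suc zero))) (y< (suc (suc (suc zero))))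

  y≗ : ∀ i → toℕ (Y i) ≡ y i
  y≗ zero                   = toℕ-fromℕ< _
  y≗ (suc zero)             = toℕ-fromℕ< _
  y≗ (suc (suc zero))       = toℕ-fromℕ< _
  y≗ (suc (suc (suc zero))) = toℕ-fromℕ< _

  x≗ : ∀ i → n ∸ 2 * toℕ (Y i) ≡ x i
  x≗ i = begin
    n ∸ 2 * toℕ (Y i)             ≡⟨ cong₂ (λ m k → m ∸ 2 * k) (sym (x+2y≡n i)) (y≗ i) ⟩
    x i + 2 * y i ∸ 2 * y i       ≡⟨ m+n∸n≡m (x i) (2 * y i) ⟩
    x i                           ∎
    where open ≡-Reasoning

theorem4p1 : ∀ (n : ℕ) → n ∈ 6 ∷ 8 ∷ 10 ∷ 14 ∷ [] →
    (G : Graph n) → Cubic G → (c : TotalColoring G 4) → Equitable c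
theorem4p1 n n∈ G cubic c i j =
  subst (_≤ 1) (cong₂ ∣_-_∣ (sym (length-colorClass c i)) (sym (length-colorClass c j)))
    (balanced n∈ (vertexClassSize c) (edgeClassSize c) (vertexClassSize+2*edgeClassSize c tight)
      (∑-vertexClassSize c) (λ _ _ → vertexClassSize≤edgeClassSize c tight) i j)
  where
  -- In a cubic graph a vertex and its three edges make exactly four elements, one for each colour.
  tight : ∀ v → 4 ≡ suc (degree G v)
  tight v = cong suc (sym (cubic v))
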